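{- For every $\Gamma\cup\{\varphi\}\subseteq For(\Sigma)$: if $\Gamma\vdash_{\mathbf{RmbC}}\varphi$ then $\Gamma\models_{\mathbb{NM}}\varphi$.
   Context: Let $\Sigma=\{\wedge,\vee,\to,\neg,\circ\}$ ($\neg,\circ$ unary, the others binary) and let $For(\Sigma)$ be the set of formulas over $\Sigma$ generated by a denumerable set $\mathcal V$ of propositional variables. $\alpha\leftrightarrow\beta$ abbreviates $(\alpha\to\beta)\wedge(\beta\to\alpha)$. $\mathbf{RmbC}$ is the Hilbert calculus with axiom schemas: (Ax1) $\alpha\to(\beta\to\alpha)$; (Ax2) $(\alpha\to(\beta\to\gamma))\to((\alpha\to\beta)\to(\alpha\to\gamma))$; (Ax3) $\alpha\to(\beta\to(\alpha\wedge\beta))$; (Ax4) $(\alpha\wedge\beta)\to\alpha$; (Ax5) $(\alpha\wedge\beta)\to\beta$; (Ax6) $\alpha\to(\alpha\vee\beta)$; (Ax7) $\beta\to(\alpha\vee\beta)$; (Ax8) $(\alpha\to\gamma)\to((\beta\to\gamma)\to((\alpha\vee\beta)\to\gamma))$; (Ax9) $(\alpha\to\beta)\vee\alpha$; (Ax10) $\alpha\vee\neg\alpha$; (bc1) $\circ\alpha\to(\alpha\to(\neg\alpha\to\beta))$; and rules: (MP) from $\alpha$ and $\alpha\to\beta$ infer $\beta$; $(\mathbf R_\neg)$ from $\alpha\leftrightarrow\beta$ infer $\neg\alpha\leftrightarrow\neg\beta$; $(\mathbf R_\circ)$ from $\alpha\leftrightarrow\beta$ infer $\circ\alpha\leftrightarrow\circ\beta$.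 A formula $\varphi$ is a theorem ($\vdash_{\mathbf{RmbC}}\varphi$) if there is a finite sequence of formulas ending in $\varphi$ each of which is an instance of an axiom schema or follows from earlier formulas of the sequence by a rule. $\Gamma\vdash_{\mathbf{RmbC}}\varphi$ means that either $\vdash_{\mathbf{RmbC}}\varphi$ or there is a finite non-empty $\{\gamma_1,\dots,\gamma_n\}\subseteq\Gamma$ with $\vdash_{\mathbf{RmbC}}(\gamma_1\wedge(\gamma_2\wedge(\cdots\wedge(\gamma_{n-1}\wedge\gamma_n)\cdots)))\to\varphi$. A neighborhood frame for $\mathbf{RmbC}$ is a triple $\mathcal F=\langle W,S_\neg,S_\circ\rangle$ with $W$ a non-empty set and $S_\neg,S_\circ:\wp(W)\to\wp(W)$ arbitrary functions. A neighborhood model is $\mathcal M=\langle\mathcal F,d\rangle$ with $d:\mathcal V\to\wp(W)$. The denotation $[\![\cdot]\!]_{\mathcal M}:For(\Sigma)\to\wp(W)$ is defined by: $[\![p]\!]=d(p)$; $[\![\varphi\wedge\psi]\!]=[\![\varphi]\!]\cap[\![\psi]\!]$; $[\![\varphi\vee\psi]\!]=[\![\varphi]\!]\cup[\![\psi]\!]$; $[\![\varphi\to\psi]\!]=(W\setminus[\![\varphi]\!])\cup[\![\psi]\!]$; $[\![\neg\varphi]\!]=(W\setminus[\![\varphi]\!])\cup S_\neg([\![\varphi]\!])$; $[\![\circ\varphi]\!]=(W\setminus([\![\varphi]\!]\cap S_\neg([\![\varphi]\!])))\cap S_\circ([\![\varphi]\!])$. $\models_{\mathbb{NM}}\varphi$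 means $[\![\varphi]\!]_{\mathcal M}=W$ for every neighborhood model $\mathcal M$. $\Gamma\models_{\mathbb{NM}}\varphi$ means that either $\models_{\mathbb{NM}}\varphi$ or there is a finite non-empty $\{\gamma_1,\dots,\gamma_n\}\subseteq\Gamma$ with $\models_{\mathbb{NM}}(\gamma_1\wedge\cdots\wedge\gamma_n)\to\varphi$. -}

module Defs where

open import Data.List.Base using (List; []; _∷_)
open import Data.List.Membership.Propositional using () renaming (_∈_ to _∈ˡ_)
open import Data.List.NonEmpty.Base using (List⁺; foldr₁)
open import Data.List.NonEmpty.Relation.Unary.All using (All)
open import Data.Nat.Base using (ℕ)
open import Data.Product.Base using (∃-syntax; _×_)
open import Data.Sum.Base using (_⊎_)
open import Function.Bundles using (_⟶ₛ_; _⟨$⟩_)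
open import Level using (Level) renaming (suc to lsuc)
open import Relation.Unary using (Pred; _∈_; _≐_; _∩_; _∪_; ∁; U)
open import Relation.Unary.Relation.Binary.Equality using (≐-setoid)

infix  9 ~_ ○_
infixr 8 _∧_
infixr 7 _∨_
infixr 6 _⇒_
infix  5 _⇔_

data Form : Set where
  var         : ℕ → Form
  _∧_ _∨_ _⇒_ : Form → Form → Form
  ~_ ○_       : Form → Form

_⇔_ : Form → Form → Form
α ⇔ β = (α ⇒ β) ∧ (β ⇒ α)

-- γ₁ ∧ (γ₂ ∧ (⋯ ∧ γₙ)), with no trailing unit.
⋀ : List⁺ Form → Form
⋀ = foldr₁ _∧_

data Axiom : Form → Set where
  Ax1  : ∀ α β   → Axiom (α ⇒ (β ⇒ α))
  Ax2  : ∀ α β γ → Axiom ((α ⇒ (β ⇒ γ)) ⇒ ((α ⇒ β) ⇒ (α ⇒ γ)))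
  Ax3  : ∀ α β   → Axiom (α ⇒ (β ⇒ (α ∧ β)))
  Ax4  : ∀ α β   → Axiom ((α ∧ β) ⇒ α)
  Ax5  : ∀ α β   → Axiom ((α ∧ β) ⇒ β)
  Ax6  : ∀ α β   → Axiom (α ⇒ (α ∨ β))
  Ax7  : ∀ α β   → Axiom (β ⇒ (α ∨ β))
  Ax8  : ∀ α β γ → Axiom ((α ⇒ γ) ⇒ ((β ⇒ γ) ⇒ ((α ∨ β) ⇒ γ)))
  Ax9  : ∀ α β   → Axiom ((α ⇒ β) ∨ α)
  Ax10 : ∀ α     → Axiom (α ∨ (~ α))
  bc1  : ∀ α β   → Axiom ((○ α) ⇒ (α ⇒ ((~ α) ⇒ β)))

data Justified (φs : List Form) : Form → Set where
  axiom : ∀ {α} → Axiom α → Justified φs α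
  MP    : ∀ {α β} → α ∈ˡ φs → (α ⇒ β) ∈ˡ φs → Justified φs β
  R~    : ∀ {α β} → (α ⇔ β) ∈ˡ φs → Justified φs ((~ α) ⇔ (~ β))
  R○    : ∀ {α β} → (α ⇔ β) ∈ˡ φs → Justified φs ((○ α) ⇔ (○ β))

-- Derivations are listed in reverse: the head is the last formula of the
-- sequence and the tail consists of the earlier ones.
data Derivation : List Form → Set where
  []  : Derivation []
  _∷_ : ∀ {φ φs} → Justified φs φ → Derivation φs → Derivation (φ ∷ φs)

infix 4 ⊢_ _⊢_

⊢_ : Form → Set
⊢ φ = ∃[ φs ] Derivation (φ ∷ φs)

-- Finite non-empty subsets of Γ are given by enumerations, possibly with
-- repetitions.
_⊢_ : ∀ {g} → Pred Form g → Form → Set g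
Γ ⊢ φ = (⊢ φ) ⊎ (∃[ γs ] (All (_∈ Γ) γs × (⊢ (⋀ γs ⇒ φ))))

-- ℘(W) is Pred W ℓ with mutual inclusion _≐_ as its equality, so a function
-- ℘(W) → ℘(W) is a map of setoids: it must send equal subsets to equal subsets.
record Frame (ℓ : Level) : Set (lsuc ℓ) where
  field
    W        : Set ℓ
    nonEmpty : W
    S~ S○    : ≐-setoid W ℓ ⟶ₛ ≐-setoid W ℓ

record Model (ℓ : Level) : Set (lsuc ℓ) where
  field
    frame : Frame ℓ
  open Frame frame public
  field
    d : ℕ → Pred W ℓ

  ⟦_⟧ : Form → Pred W ℓ
  ⟦ var p ⟧ = d p
  ⟦ φ ∧ ψ ⟧ = ⟦ φ ⟧ ∩ ⟦ ψ ⟧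
  ⟦ φ ∨ ψ ⟧ = ⟦ φ ⟧ ∪ ⟦ ψ ⟧
  ⟦ φ ⇒ ψ ⟧ = ∁ ⟦ φ ⟧ ∪ ⟦ ψ ⟧
  ⟦ ~ φ   ⟧ = ∁ ⟦ φ ⟧ ∪ (S~ ⟨$⟩ ⟦ φ ⟧)
  ⟦ ○ φ   ⟧ = ∁ (⟦ φ ⟧ ∩ (S~ ⟨$⟩ ⟦ φ ⟧)) ∩ (S○ ⟨$⟩ ⟦ φ ⟧)

infix 4 ⊨[_]_ _⊨[_]_

-- The level ℓ is the size of the worlds and subsets of the models considered.
⊨[_]_ : ∀ ℓ → Form → Set (lsuc ℓ)
⊨[ ℓ ] φ = (M : Model ℓ) → Model.⟦_⟧ M φ ≐ U

_⊨[_]_ : ∀ {g} → Pred Form g → ∀ ℓ → Form → Set _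
Γ ⊨[ ℓ ] φ = (⊨[ ℓ ] φ) ⊎ (∃[ γs ] (All (_∈ Γ) γs × (⊨[ ℓ ] (⋀ γs ⇒ φ))))

{-# OPTIONS --safe #-}
module Submission where

open import Defs
open import Axiom.ExcludedMiddle using (ExcludedMiddle)
open import Data.List.Relation.Unary.All as All using (All; []; _∷_)
open import Data.Product.Base as Product using (_,_; proj₁; proj₂)
open import Data.Sum.Base as Sum using (_⊎_; inj₁; inj₂; [_,_])
open import Data.Unit.Base using (tt)
open import Function.Base using (_∘_; const)
open import Function.Bundles using (Func)
open import Level using (Level)
open import Relation.Nullary using (¬_; contradiction; contraposition; toSum)
open import Relation.Unary using (Pred; _≐_; Universal)

-- Fix a model; every formula of a derivation denotes all of `W`. At each world the connectives `∧`,
-- `∨`, `⇒` behave classically, which settles the positive axioms, and `bc1` holds because `○ α`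
-- rules out `α` together with `S~` of its denotation. The rules `R~` and `R○` preserve validity
-- because the denotations of `~ α` and `○ α` depend only on the subset denoted by `α`.

⊎-elim : ∀ {a b} {A : Set a} {B : Set b} → ¬ A ⊎ B → A → B
⊎-elim = [ (λ ¬a a → contradiction a ¬a) , const ]

module Soundness {ℓ : Level} (em : ExcludedMiddle ℓ) (M : Model ℓ) where
  open Model M

  -- An implication denotes a union with a complement, so introducing one means deciding `A`; this
  -- direction is classical, while `⊎-elim` is constructive.
  ⊎-intro : {A B : Set ℓ} → (A → B) → ¬ A ⊎ B
  ⊎-intro f = Sum.map₂ f (Sum.swap (toSum em))

  -- Truth at every world is essential: `S~` and `S○` act on whole subsets, not on single worlds.
  ⇔⇒≐ : ∀ {α β} → Universal ⟦ α ⇔ β ⟧ → ⟦ α ⟧ ≐ ⟦ β ⟧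
  ⇔⇒≐ v = ⊎-elim (proj₁ (v _)) , ⊎-elim (proj₂ (v _))

  ≐⇒⇔ : ∀ {α β} → ⟦ α ⟧ ≐ ⟦ β ⟧ → Universal ⟦ α ⇔ β ⟧
  ≐⇒⇔ (α⊆β , β⊆α) w = ⊎-intro α⊆β , ⊎-intro β⊆α

  -- Complement reverses inclusions, so each half uses the opposite inclusion; `S~` need not be
  -- monotone, only respect equality of subsets.
  ~-cong : ∀ {α β} → ⟦ α ⟧ ≐ ⟦ β ⟧ → ⟦ ~ α ⟧ ≐ ⟦ ~ β ⟧
  ~-cong α≐β@(α⊆β , β⊆α) with S~α⊆S~β , S~β⊆S~α ← Func.cong S~ α≐β =
    Sum.map (contraposition β⊆α) S~α⊆S~β , Sum.map (contraposition α⊆β) S~β⊆S~α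

  ○-cong : ∀ {α β} → ⟦ α ⟧ ≐ ⟦ β ⟧ → ⟦ ○ α ⟧ ≐ ⟦ ○ β ⟧
  ○-cong α≐β@(α⊆β , β⊆α)
    with S~α⊆S~β , S~β⊆S~α ← Func.cong S~ α≐β
       | S○α⊆S○β , S○β⊆S○α ← Func.cong S○ α≐β =
    Product.map (contraposition (Product.map β⊆α S~β⊆S~α)) S○α⊆S○β ,
    Product.map (contraposition (Product.map α⊆β S~α⊆S~β)) S○β⊆S○α

  axiom-sound : ∀ {φ} → Axiom φ → Universal ⟦ φ ⟧
  axiom-sound (Ax1 α β)   w = ⊎-intro λ a → ⊎-intro λ _ → a
  axiom-sound (Ax2 α β γ) w = ⊎-intro λ f → ⊎-intro λ g → ⊎-intro λ a →
    ⊎-elim (⊎-elim f a) (⊎-elim g a)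
  axiom-sound (Ax3 α β)   w = ⊎-intro λ a → ⊎-intro λ b → a , b
  axiom-sound (Ax4 α β)   w = ⊎-intro proj₁
  axiom-sound (Ax5 α β)   w = ⊎-intro proj₂
  axiom-sound (Ax6 α β)   w = ⊎-intro inj₁
  axiom-sound (Ax7 α β)   w = ⊎-intro inj₂
  axiom-sound (Ax8 α β γ) w = ⊎-intro λ f → ⊎-intro λ g → ⊎-intro
    [ ⊎-elim f , ⊎-elim g ]
  axiom-sound (Ax9 α β)   w = Sum.swap (Sum.map₂ inj₁ (toSum em))
  axiom-sound (Ax10 α)    w = Sum.map₂ inj₁ (toSum em)
  -- Where `α` holds, `~ α` can hold only through `S~`, which the first component of `○ α` forbids.
  axiom-sound (bc1 α β)   w = ⊎-intro λ (consistent , _) → ⊎-intro λ a → ⊎-intro λ ¬a →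
    contradiction (a , ⊎-elim ¬a a) consistent

  justified-sound : ∀ {φs φ} → All (Universal ∘ ⟦_⟧) φs → Justified φs φ → Universal ⟦ φ ⟧
  justified-sound vs (axiom ax) = axiom-sound ax
  justified-sound vs (MP i j) w = ⊎-elim (All.lookup vs j w) (All.lookup vs i w)
  justified-sound vs (R~ {α} {β} i) =
    ≐⇒⇔ {~ α} {~ β} (~-cong {α} {β} (⇔⇒≐ {α} {β} (All.lookup vs i)))
  justified-sound vs (R○ {α} {β} i) =
    ≐⇒⇔ {○ α} {○ β} (○-cong {α} {β} (⇔⇒≐ {α} {β} (All.lookup vs i)))

  -- The induction carries the whole sequence, since a rule may cite any earlier formula.
  derivation-sound : ∀ {φs} → Derivation φs → All (Universal ∘ ⟦_⟧) φs
  derivation-sound []      = []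
  derivation-sound (j ∷ δ) = justified-sound vs j ∷ vs
    where vs = derivation-sound δ

⊢⇒⊨ : ∀ {ℓ} → ExcludedMiddle ℓ → ∀ {φ} → ⊢ φ → ⊨[ ℓ ] φ
⊢⇒⊨ em (_ , δ) M = (λ _ → tt) , λ _ → All.head (Soundness.derivation-sound em M δ) _

corollary5p5 : ∀ {g ℓ : Level} → ExcludedMiddle ℓ →
    (Γ : Pred Form g) (φ : Form) → Γ ⊢ φ → Γ ⊨[ ℓ ] φ
-- Both consequence relations reduce to theoremhood or validity in the same way, so the same `γs`
-- serves.
corollary5p5 em Γ φ = Sum.map (⊢⇒⊨ em) (Product.map₂ (Product.map₂ (⊢⇒⊨ em)))
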